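{- Let $G$ be a graph of order $n$ with minimum degree $\delta=\delta(G)$, let $\bar\delta=\delta(\overline{G})$ be the minimum degree of its complement $\overline{G}$, and let $\delta'=\min\{\delta,\bar\delta\}$. If $\delta'>0$, then $$ \gamma_g(G)\le\left(1-\frac{\delta'}{2^{1/\delta'}\,(1+\delta')^{1+1/\delta'}}\right)n . $$
   Context: All graphs are finite and undirected, without loops or multiple edges. A set $X\subseteq V(G)$ is a dominating set of $G$ if every vertex not in $X$ is adjacent in $G$ to a vertex in $X$. A set $X\subseteq V(G)$ is a global dominating set of $G$ if it is a dominating set both in $G$ and in its complement $\overline{G}$. The global domination number $\gamma_g(G)$ is the minimum cardinality of a global dominating set of $G$. -}

module Defs where

open import Data.Empty using (⊥-elim)
open import Data.Fin using (Fin)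
open import Data.Fin.Properties as Fin using (all?; any?)
open import Data.Fin.Subset using (Subset; inside; outside; _∈_; _∉_; ∣_∣)
open import Data.Fin.Subset.Properties using (_∈?_)
open import Data.Integer as ℤ using (ℤ; +_; -[1+_])
import Data.Integer.Properties as ℤ
open import Data.List using (List; []; _∷_; _++_; map; filter; allFin)
open import Data.List.Extrema.Nat using (min)
open import Data.Nat as ℕ using (ℕ; zero; suc; NonZero)
import Data.Nat.DivMod as ℕ
import Data.Nat.Properties as ℕ
open import Data.Nat.Solver using (module +-*-Solver)
open import Data.Product using (∃; _×_; _,_; proj₁; proj₂)
open import Data.Rational as ℚ using (ℚ; mkℚ; 0ℚ; 1ℚ; ½)
import Data.Rational.Properties as ℚ
import Data.Rational.Solver as ℚ
import Data.Rational.Unnormalised as ℚᵘ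
import Data.Rational.Unnormalised.Properties as ℚᵘ
open import Data.Sum using (inj₁; inj₂)
open import Data.Vec using ([]; _∷_; tabulate)
open import Relation.Binary.Definitions using (Decidable; Symmetric; Irreflexive)
open import Relation.Binary.PropositionalEquality
open import Relation.Nullary using (¬_; Dec; yes; no; does; ¬?)
open import Relation.Nullary.Decidable using (_×-dec_; _→-dec_)

------------------------------------------------------------------------
-- Graphs

record Graph (n : ℕ) : Set₁ where
  field
    Adj    : Fin n → Fin n → Set
    adj?   : Decidable Adj
    symm   : Symmetric Adj
    irrefl : Irreflexive _≡_ Adj

open Graph public

complement : ∀ {n} → Graph n → Graph n
complement G .Adj u v = u ≢ v × ¬ Adj G u v
complement G .adj? u v = ¬? (u Fin.≟ v) ×-dec ¬? (adj? G u v)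
complement G .symm (u≢v , u≁v) = (λ v≡u → u≢v (sym v≡u)) , λ v~u → u≁v (symm G v~u)
complement G .irrefl u≡v (u≢v , _) = u≢v u≡v

neighbourhood : ∀ {n} → Graph n → Fin n → Subset n
neighbourhood G v = tabulate λ u → does (adj? G v u)

degree : ∀ {n} → Graph n → Fin n → ℕ
degree G v = ∣ neighbourhood G v ∣

-- Degrees are smaller than n, so the default value n given to `min`
-- matters only for the graph of order 0, which gets minimum degree 0.
minDegree : ∀ {n} → Graph n → ℕ
minDegree {n} G = min n (map (degree G) (allFin n))

Dominating : ∀ {n} → Graph n → Subset n → Set
Dominating G X = ∀ v → v ∉ X → ∃ λ u → u ∈ X × Adj G v u

GlobalDominating : ∀ {n} → Graph n → Subset n → Set
GlobalDominating G X = Dominating G X × Dominating (complement G) X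

dominating? : ∀ {n} (G : Graph n) X → Dec (Dominating G X)
dominating? G X =
  all? λ v → ¬? (v ∈? X) →-dec any? λ u → (u ∈? X) ×-dec adj? G v u

globalDominating? : ∀ {n} (G : Graph n) X → Dec (GlobalDominating G X)
globalDominating? G X = dominating? G X ×-dec dominating? (complement G) X

subsets : ∀ n → List (Subset n)
subsets zero    = [] ∷ []
subsets (suc n) = map (outside ∷_) (subsets n) ++ map (inside ∷_) (subsets n)

-- The whole vertex set is a global dominating set, so the default
-- value n given to `min` never lowers the minimum.
globalDominationNumber : ∀ {n} → Graph n → ℕ
globalDominationNumber {n} G =
  min n (map ∣_∣ (filter (globalDominating? G) (subsets n)))

------------------------------------------------------------------------
-- Auxiliary facts about ℚ

half+half : ∀ p → ½ ℚ.* p ℚ.+ ½ ℚ.* p ≡ p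
half+half = solve 1 (λ p → con ½ :* p :+ con ½ :* p := p) refl
  where open ℚ.+-*-Solver

*-pos : ∀ {p q} → 0ℚ ℚ.< p → 0ℚ ℚ.< q → 0ℚ ℚ.< p ℚ.* q
*-pos {p} {q} 0<p 0<q =
  ℚ.positive⁻¹ _ {{ℚ.pos*pos⇒pos p {{ℚ.positive 0<p}} q {{ℚ.positive 0<q}}}}

half-pos : ∀ {p} → 0ℚ ℚ.< p → 0ℚ ℚ.< ½ ℚ.* p
half-pos = *-pos (ℚ.positive⁻¹ ½)

*-mono : ∀ {p p′ q q′} → 0ℚ ℚ.≤ q → 0ℚ ℚ.≤ p′ → p ℚ.≤ p′ → q ℚ.≤ q′ →
         p ℚ.* q ℚ.≤ p′ ℚ.* q′
*-mono {p} {p′} {q} {q′} 0≤q 0≤p′ p≤p′ q≤q′ = ℚ.≤-trans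
  (ℚ.*-monoʳ-≤-nonNeg q {{ℚ.nonNegative 0≤q}} p≤p′)
  (ℚ.*-monoˡ-≤-nonNeg p′ {{ℚ.nonNegative 0≤p′}} q≤q′)

p-q≤r⇒p≤q+r : ∀ {p q r} → p ℚ.- q ℚ.≤ r → p ℚ.≤ q ℚ.+ r
p-q≤r⇒p≤q+r {p} {q} {r} h =
  subst (ℚ._≤ q ℚ.+ r) (solve 2 (λ p q → q :+ (p :- q) := p) refl p q) (ℚ.+-monoʳ-≤ q h)
  where open ℚ.+-*-Solver

p≤q+r⇒p-q≤r : ∀ {p q r} → p ℚ.≤ q ℚ.+ r → p ℚ.- q ℚ.≤ r
p≤q+r⇒p-q≤r {p} {q} {r} h =
  subst (p ℚ.- q ℚ.≤_) (solve 2 (λ q r → q :+ r :- q := r) refl q r) (ℚ.+-monoˡ-≤ (ℚ.- q) h)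
  where open ℚ.+-*-Solver

neg-sub : ∀ p q → ℚ.- (p ℚ.- q) ≡ q ℚ.- p
neg-sub = solve 2 (λ p q → :- (p :- q) := q :- p) refl
  where open ℚ.+-*-Solver

abs-sub≤ : ∀ {p q ε} → p ℚ.≤ q ℚ.+ ε → q ℚ.≤ p ℚ.+ ε → ℚ.∣ p ℚ.- q ∣ ℚ.≤ ε
abs-sub≤ {p} {q} {ε} p≤q+ε q≤p+ε with ℚ.∣p∣≡p∨∣p∣≡-p (p ℚ.- q)
... | inj₁ eq = subst (ℚ._≤ ε) (sym eq) (p≤q+r⇒p-q≤r p≤q+ε)
... | inj₂ eq = subst (ℚ._≤ ε) (sym (trans eq (neg-sub p q))) (p≤q+r⇒p-q≤r q≤p+ε)

p≤∣p∣ : ∀ p → p ℚ.≤ ℚ.∣ p ∣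
p≤∣p∣ p with ℚ.≤-total 0ℚ p
... | inj₁ 0≤p = ℚ.≤-reflexive (sym (ℚ.0≤p⇒∣p∣≡p 0≤p))
... | inj₂ p≤0 = ℚ.≤-trans p≤0 (ℚ.0≤∣p∣ p)

-- Total reciprocal, with recip 0ℚ = 0ℚ, so that it applies to every
-- term of a sequence; only positive terms matter in `_⁻¹` below.
recip : ℚ → ℚ
recip p with p ℚ.≟ 0ℚ
... | yes _  = 0ℚ
... | no p≢0 = (ℚ.1/ p) {{ℚ.≢-nonZero p≢0}}

*-recip : ∀ {p} → 0ℚ ℚ.< p → p ℚ.* recip p ≡ 1ℚ
*-recip {p} 0<p with p ℚ.≟ 0ℚ
... | yes p≡0 = ⊥-elim (ℚ.<⇒≢ 0<p (sym p≡0))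
... | no p≢0  = ℚ.*-inverseʳ p {{ℚ.≢-nonZero p≢0}}

recip-pos : ∀ {p} → 0ℚ ℚ.< p → 0ℚ ℚ.< recip p
recip-pos {p} 0<p with p ℚ.≟ 0ℚ
... | yes p≡0 = ⊥-elim (ℚ.<⇒≢ 0<p (sym p≡0))
... | no p≢0  = ℚ.positive⁻¹ _ {{ℚ.1/pos⇒pos p {{ℚ.positive 0<p}}}}

recip-anti : ∀ {p q} → 0ℚ ℚ.< p → p ℚ.≤ q → recip q ℚ.≤ recip p
recip-anti {p} {q} 0<p p≤q = subst₂ ℚ._≤_ lhs rhs step
  where
  open ℚ.+-*-Solver
  0<q = ℚ.<-≤-trans 0<p p≤q
  step : p ℚ.* (recip p ℚ.* recip q) ℚ.≤ q ℚ.* (recip p ℚ.* recip q)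
  step = ℚ.*-monoʳ-≤-nonNeg _
    {{ℚ.nonNegative (ℚ.<⇒≤ (*-pos (recip-pos 0<p) (recip-pos 0<q)))}} p≤q
  lhs : p ℚ.* (recip p ℚ.* recip q) ≡ recip q
  lhs = trans (sym (ℚ.*-assoc p (recip p) (recip q)))
       (trans (cong (ℚ._* recip q) (*-recip 0<p)) (ℚ.*-identityˡ _))
  rhs : q ℚ.* (recip p ℚ.* recip q) ≡ recip p
  rhs = trans (solve 3 (λ q a b → q :* (a :* b) := q :* b :* a) refl q (recip p) (recip q))
       (trans (cong (ℚ._* recip p) (*-recip 0<q)) (ℚ.*-identityˡ _))

abs-bound : ∀ p q {r} → ℚ.∣ p ℚ.- q ∣ ℚ.≤ r → ℚ.∣ p ∣ ℚ.≤ ℚ.∣ q ∣ ℚ.+ r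
abs-bound p q {r} h = ℚ.≤-trans
  (subst (λ t → ℚ.∣ t ∣ ℚ.≤ ℚ.∣ q ∣ ℚ.+ ℚ.∣ p ℚ.- q ∣)
    (solve 2 (λ p q → q :+ (p :- q) := p) refl p q) (ℚ.∣p+q∣≤∣p∣+∣q∣ q (p ℚ.- q)))
  (ℚ.+-monoʳ-≤ ℚ.∣ q ∣ h)
  where open ℚ.+-*-Solver

*-close : ∀ {a b c d B C ε} → 0ℚ ℚ.< ε → 0ℚ ℚ.< B → 0ℚ ℚ.< C →
          ℚ.∣ a ∣ ℚ.≤ B → ℚ.∣ d ∣ ℚ.≤ C →
          ℚ.∣ a ℚ.- b ∣ ℚ.≤ ε ℚ.* recip (B ℚ.+ C) →
          ℚ.∣ c ℚ.- d ∣ ℚ.≤ ε ℚ.* recip (B ℚ.+ C) →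
          ℚ.∣ a ℚ.* c ℚ.- b ℚ.* d ∣ ℚ.≤ ε
*-close {a} {b} {c} {d} {B} {C} {ε} 0<ε 0<B 0<C a≤B d≤C a~b c~d = begin
  ℚ.∣ a ℚ.* c ℚ.- b ℚ.* d ∣
    ≡⟨ cong ℚ.∣_∣ (regroup a b c d) ⟩
  ℚ.∣ a ℚ.* (c ℚ.- d) ℚ.+ (a ℚ.- b) ℚ.* d ∣
    ≤⟨ ℚ.∣p+q∣≤∣p∣+∣q∣ (a ℚ.* (c ℚ.- d)) ((a ℚ.- b) ℚ.* d) ⟩
  ℚ.∣ a ℚ.* (c ℚ.- d) ∣ ℚ.+ ℚ.∣ (a ℚ.- b) ℚ.* d ∣
    ≡⟨ cong₂ ℚ._+_ (ℚ.∣p*q∣≡∣p∣*∣q∣ a (c ℚ.- d)) (ℚ.∣p*q∣≡∣p∣*∣q∣ (a ℚ.- b) d) ⟩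
  ℚ.∣ a ∣ ℚ.* ℚ.∣ c ℚ.- d ∣ ℚ.+ ℚ.∣ a ℚ.- b ∣ ℚ.* ℚ.∣ d ∣
    ≤⟨ ℚ.+-mono-≤
         (*-mono (ℚ.0≤∣p∣ (c ℚ.- d)) (ℚ.<⇒≤ 0<B) a≤B c~d)
         (*-mono (ℚ.0≤∣p∣ d) (ℚ.<⇒≤ 0<η) a~b d≤C) ⟩
  B ℚ.* η ℚ.+ η ℚ.* C
    ≡⟨ collect B C ε (recip (B ℚ.+ C)) ⟩
  ε ℚ.* ((B ℚ.+ C) ℚ.* recip (B ℚ.+ C))
    ≡⟨ cong (ε ℚ.*_) (*-recip (ℚ.+-mono-< 0<B 0<C)) ⟩
  ε ℚ.* 1ℚ
    ≡⟨ ℚ.*-identityʳ ε ⟩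
  ε ∎
  where
  open ℚ.≤-Reasoning
  open ℚ.+-*-Solver using (solve; _:+_; _:*_; _:-_; _:=_)
  η = ε ℚ.* recip (B ℚ.+ C)
  0<η = *-pos 0<ε (recip-pos (ℚ.+-mono-< 0<B 0<C))
  regroup : ∀ a b c d → a ℚ.* c ℚ.- b ℚ.* d ≡ a ℚ.* (c ℚ.- d) ℚ.+ (a ℚ.- b) ℚ.* d
  regroup = solve 4 (λ a b c d → a :* c :- b :* d := a :* (c :- d) :+ (a :- b) :* d) refl
  collect : ∀ B C ε r → B ℚ.* (ε ℚ.* r) ℚ.+ (ε ℚ.* r) ℚ.* C ≡ ε ℚ.* ((B ℚ.+ C) ℚ.* r)
  collect = solve 4 (λ B C ε r → B :* (ε :* r) :+ (ε :* r) :* C := ε :* ((B :+ C) :* r)) refl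

recip-close : ∀ {a b q ε} → 0ℚ ℚ.< q → q ℚ.≤ a → q ℚ.≤ b →
              ℚ.∣ b ℚ.- a ∣ ℚ.≤ ε ℚ.* (q ℚ.* q) →
              ℚ.∣ recip a ℚ.- recip b ∣ ℚ.≤ ε
recip-close {a} {b} {q} {ε} 0<q q≤a q≤b a~b = begin
  ℚ.∣ recip a ℚ.- recip b ∣
    ≡⟨ cong ℚ.∣_∣ difference ⟩
  ℚ.∣ (recip a ℚ.* recip b) ℚ.* (b ℚ.- a) ∣
    ≡⟨ ℚ.∣p*q∣≡∣p∣*∣q∣ (recip a ℚ.* recip b) (b ℚ.- a) ⟩
  ℚ.∣ recip a ℚ.* recip b ∣ ℚ.* ℚ.∣ b ℚ.- a ∣
    ≡⟨ cong (ℚ._* ℚ.∣ b ℚ.- a ∣)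
         (ℚ.0≤p⇒∣p∣≡p (ℚ.<⇒≤ (*-pos (recip-pos 0<a) (recip-pos 0<b)))) ⟩
  (recip a ℚ.* recip b) ℚ.* ℚ.∣ b ℚ.- a ∣
    ≤⟨ *-mono (ℚ.0≤∣p∣ (b ℚ.- a)) (ℚ.<⇒≤ (*-pos (recip-pos 0<q) (recip-pos 0<q)))
         (*-mono (ℚ.<⇒≤ (recip-pos 0<b)) (ℚ.<⇒≤ (recip-pos 0<q))
           (recip-anti 0<q q≤a) (recip-anti 0<q q≤b))
         a~b ⟩
  (recip q ℚ.* recip q) ℚ.* (ε ℚ.* (q ℚ.* q))
    ≡⟨ regroup q (recip q) ε ⟩
  ε ℚ.* ((q ℚ.* recip q) ℚ.* (q ℚ.* recip q))
    ≡⟨ cong (λ t → ε ℚ.* (t ℚ.* t)) (*-recip 0<q) ⟩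
  ε ℚ.* (1ℚ ℚ.* 1ℚ)
    ≡⟨ trans (cong (ε ℚ.*_) (ℚ.*-identityʳ 1ℚ)) (ℚ.*-identityʳ ε) ⟩
  ε ∎
  where
  open ℚ.≤-Reasoning
  open ℚ.+-*-Solver using (solve; _:+_; _:*_; _:-_; _:=_)
  0<a = ℚ.<-≤-trans 0<q q≤a
  0<b = ℚ.<-≤-trans 0<q q≤b
  regroup : ∀ q r ε → (r ℚ.* r) ℚ.* (ε ℚ.* (q ℚ.* q)) ≡ ε ℚ.* ((q ℚ.* r) ℚ.* (q ℚ.* r))
  regroup = solve 3 (λ q r ε → (r :* r) :* (ε :* (q :* q)) := ε :* ((q :* r) :* (q :* r))) refl
  expand : ∀ a b r s → (r ℚ.* s) ℚ.* (b ℚ.- a) ≡ r ℚ.* (b ℚ.* s) ℚ.- (a ℚ.* r) ℚ.* s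
  expand = solve 4 (λ a b r s → (r :* s) :* (b :- a) := r :* (b :* s) :- (a :* r) :* s) refl
  difference : recip a ℚ.- recip b ≡ (recip a ℚ.* recip b) ℚ.* (b ℚ.- a)
  difference = sym (trans (expand a b (recip a) (recip b))
    (cong₂ ℚ._-_
      (trans (cong (recip a ℚ.*_) (*-recip 0<b)) (ℚ.*-identityʳ (recip a)))
      (trans (cong (ℚ._* recip b) (*-recip 0<a)) (ℚ.*-identityˡ (recip b)))))

------------------------------------------------------------------------
-- Real numbers, as Cauchy sequences of rationals

Cauchy : (ℕ → ℚ) → Set
Cauchy x = ∀ ε → 0ℚ ℚ.< ε →
  ∃ λ N → ∀ m n → N ℕ.≤ m → N ℕ.≤ n → ℚ.∣ x m ℚ.- x n ∣ ℚ.≤ ε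

record ℝ : Set where
  no-eta-equality
  field
    seq    : ℕ → ℚ
    cauchy : Cauchy seq

open ℝ public

infix 4 _≤_

-- Order of the limits: pointwise comparison would distinguish
-- sequences representing the same real.
_≤_ : ℝ → ℝ → Set
x ≤ y = ∀ ε → 0ℚ ℚ.< ε →
  ∃ λ N → ∀ n → N ℕ.≤ n → seq x n ℚ.≤ seq y n ℚ.+ ε

record Positive (x : ℝ) : Set where
  no-eta-equality
  field
    bound     : ℚ
    bound-pos : 0ℚ ℚ.< bound
    from      : ℕ
    bound≤    : ∀ n → from ℕ.≤ n → bound ℚ.≤ seq x n

open Positive

-- Abstract because unfolding the bound makes type checking very slow.
abstract
  bounded : ∀ x → ∃ λ B → 0ℚ ℚ.< B × ∃ λ N → ∀ n → N ℕ.≤ n → ℚ.∣ seq x n ∣ ℚ.≤ B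
  bounded x =
    let N , h = cauchy x 1ℚ (ℚ.positive⁻¹ 1ℚ)
    in ℚ.∣ seq x N ∣ ℚ.+ 1ℚ
     , ℚ.+-mono-≤-< (ℚ.0≤∣p∣ (seq x N)) (ℚ.positive⁻¹ 1ℚ)
     , N
     , λ n N≤n → abs-bound (seq x n) (seq x N) (h n N N≤n ℕ.≤-refl)

fromℚ : ℚ → ℝ
fromℚ p .seq _ = p
fromℚ p .cauchy ε 0<ε =
  0 , λ _ _ _ _ → subst (ℚ._≤ ε) (cong ℚ.∣_∣ (sym (ℚ.+-inverseʳ p))) (ℚ.<⇒≤ 0<ε)

fromℕ : ℕ → ℝ
fromℕ n = fromℚ (+ n ℚ./ 1)

infixl 6 _+_

_+_ : ℝ → ℝ → ℝ
(x + y) .seq n = seq x n ℚ.+ seq y n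
(x + y) .cauchy ε 0<ε with cauchy x (½ ℚ.* ε) (half-pos 0<ε) | cauchy y (½ ℚ.* ε) (half-pos 0<ε)
... | M , hx | N , hy = M ℕ.⊔ N , λ m n ≤m ≤n →
  subst₂ ℚ._≤_
    (cong ℚ.∣_∣ (regroup (seq x m) (seq x n) (seq y m) (seq y n)))
    (half+half ε)
    (ℚ.≤-trans (ℚ.∣p+q∣≤∣p∣+∣q∣ (seq x m ℚ.- seq x n) (seq y m ℚ.- seq y n))
      (ℚ.+-mono-≤
        (hx m n (ℕ.m⊔n≤o⇒m≤o M N ≤m) (ℕ.m⊔n≤o⇒m≤o M N ≤n))
        (hy m n (ℕ.m⊔n≤o⇒n≤o M N ≤m) (ℕ.m⊔n≤o⇒n≤o M N ≤n))))
  where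
  open ℚ.+-*-Solver
  regroup : ∀ a b c d → (a ℚ.- b) ℚ.+ (c ℚ.- d) ≡ (a ℚ.+ c) ℚ.- (b ℚ.+ d)
  regroup = solve 4 (λ a b c d → (a :- b) :+ (c :- d) := (a :+ c) :- (b :+ d)) refl

infix 8 -_

-_ : ℝ → ℝ
(- x) .seq n = ℚ.- seq x n
(- x) .cauchy ε 0<ε with cauchy x ε 0<ε
... | N , h = N , λ m n ≤m ≤n →
  subst (ℚ._≤ ε)
    (trans (sym (ℚ.∣-p∣≡∣p∣ (seq x m ℚ.- seq x n)))
           (cong ℚ.∣_∣ (ℚ.neg-distrib-+ (seq x m) (ℚ.- seq x n))))
    (h m n ≤m ≤n)

infixl 6 _-_

_-_ : ℝ → ℝ → ℝ
x - y = x + - y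

infixl 7 _*_

_*_ : ℝ → ℝ → ℝ
(x * y) .seq n = seq x n ℚ.* seq y n
(x * y) .cauchy ε 0<ε =
  let B , 0<B , K , hB = bounded x
      C , 0<C , L , hC = bounded y
      0<η = *-pos 0<ε (recip-pos (ℚ.+-mono-< 0<B 0<C))
      M , hx = cauchy x (ε ℚ.* recip (B ℚ.+ C)) 0<η
      N , hy = cauchy y (ε ℚ.* recip (B ℚ.+ C)) 0<η
  in (K ℕ.⊔ L) ℕ.⊔ (M ℕ.⊔ N) , λ m n ≤m ≤n →
  let K≤m = ℕ.m⊔n≤o⇒m≤o K L (ℕ.m⊔n≤o⇒m≤o (K ℕ.⊔ L) (M ℕ.⊔ N) ≤m)
      L≤n = ℕ.m⊔n≤o⇒n≤o K L (ℕ.m⊔n≤o⇒m≤o (K ℕ.⊔ L) (M ℕ.⊔ N) ≤n)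
      ≤m′ = ℕ.m⊔n≤o⇒n≤o (K ℕ.⊔ L) (M ℕ.⊔ N) ≤m
      ≤n′ = ℕ.m⊔n≤o⇒n≤o (K ℕ.⊔ L) (M ℕ.⊔ N) ≤n
  in *-close {ε = ε} 0<ε 0<B 0<C (hB m K≤m) (hC n L≤n)
       (hx m n (ℕ.m⊔n≤o⇒m≤o M N ≤m′) (ℕ.m⊔n≤o⇒m≤o M N ≤n′))
       (hy m n (ℕ.m⊔n≤o⇒n≤o M N ≤m′) (ℕ.m⊔n≤o⇒n≤o M N ≤n′))

infix 9 _⁻¹

_⁻¹ : (x : ℝ) → {{Positive x}} → ℝ
(x ⁻¹) .seq n = recip (seq x n)
(x ⁻¹) {{x>0}} .cauchy ε 0<ε =
  let q   = bound x>0
      0<q = bound-pos x>0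
      N , h = cauchy x (ε ℚ.* (q ℚ.* q)) (*-pos 0<ε (*-pos 0<q 0<q))
  in from x>0 ℕ.⊔ N , λ m n ≤m ≤n →
       recip-close {ε = ε} 0<q
         (bound≤ x>0 m (ℕ.m⊔n≤o⇒m≤o (from x>0) N ≤m))
         (bound≤ x>0 n (ℕ.m⊔n≤o⇒m≤o (from x>0) N ≤n))
         (h n m (ℕ.m⊔n≤o⇒n≤o (from x>0) N ≤n) (ℕ.m⊔n≤o⇒n≤o (from x>0) N ≤m))

infixl 7 _/_

_/_ : (x y : ℝ) → {{Positive y}} → ℝ
x / y = x * y ⁻¹

instance
  *-positive : ∀ {x y} → {{Positive x}} → {{Positive y}} → Positive (x * y)
  *-positive {{p}} {{q}} .bound = bound p ℚ.* bound q
  *-positive {{p}} {{q}} .bound-pos = *-pos (bound-pos p) (bound-pos q)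
  *-positive {{p}} {{q}} .from = from p ℕ.⊔ from q
  *-positive {x} {y} {{p}} {{q}} .bound≤ n ≤n =
    let p≤x = bound≤ p n (ℕ.m⊔n≤o⇒m≤o (from p) (from q) ≤n)
        q≤y = bound≤ q n (ℕ.m⊔n≤o⇒n≤o (from p) (from q) ≤n)
    in *-mono (ℚ.<⇒≤ (bound-pos q)) (ℚ.<⇒≤ (ℚ.<-≤-trans (bound-pos p) p≤x)) p≤x q≤y

  ⁻¹-positive : ∀ {x} {{p : Positive x}} → Positive (x ⁻¹)
  ⁻¹-positive {x} .bound = recip (proj₁ (bounded x))
  ⁻¹-positive {x} .bound-pos = recip-pos (proj₁ (proj₂ (bounded x)))
  ⁻¹-positive {x} {{p}} .from = from p ℕ.⊔ proj₁ (proj₂ (proj₂ (bounded x)))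
  ⁻¹-positive {x} {{p}} .bound≤ n ≤n =
    recip-anti {seq x n} {proj₁ (bounded x)}
      (ℚ.<-≤-trans (bound-pos p) (bound≤ p n (ℕ.m⊔n≤o⇒m≤o (from p) _ ≤n)))
      (ℚ.≤-trans (p≤∣p∣ (seq x n))
        (proj₂ (proj₂ (proj₂ (bounded x))) n (ℕ.m⊔n≤o⇒n≤o (from p) _ ≤n)))

------------------------------------------------------------------------
-- Roots and rational powers of natural numbers

raise : ℕ → ℕ → ℕ → ℕ
raise q b r with b ℕ.≤? r ℕ.^ q
... | yes _ = r
... | no  _ = suc r

-- The least r with b ≤ r ^ q (for q ≥ 1); see the two lemmas below.
⌈root⌉ : ℕ → ℕ → ℕ
⌈root⌉ q zero    = 0
⌈root⌉ q (suc b) = raise q (suc b) (⌈root⌉ q b)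

⌈root⌉-upper : ∀ q .{{_ : NonZero q}} b → b ℕ.≤ ⌈root⌉ q b ℕ.^ q
⌈root⌉-upper q zero = ℕ.z≤n
⌈root⌉-upper q (suc b) with suc b ℕ.≤? ⌈root⌉ q b ℕ.^ q
... | yes p = p
... | no  _ = ℕ.≤-<-trans (⌈root⌉-upper q b) (ℕ.^-monoˡ-< q (ℕ.n<1+n _))

⌈root⌉-least : ∀ q b j → b ℕ.≤ j ℕ.^ q → ⌈root⌉ q b ℕ.≤ j
⌈root⌉-least q zero j _ = ℕ.z≤n
⌈root⌉-least q (suc b) j h with suc b ℕ.≤? ⌈root⌉ q b ℕ.^ q
... | yes _ = ⌈root⌉-least q b j (ℕ.<⇒≤ h)
... | no ¬p = ℕ.≤∧≢⇒< (⌈root⌉-least q b j (ℕ.<⇒≤ h))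
                λ r≡j → ¬p (subst (λ t → suc b ℕ.≤ t ℕ.^ q) (sym r≡j) h)

approx : ℕ → ℕ → ℕ → ℕ
approx q a k = ⌈root⌉ q (a ℕ.* suc k ℕ.^ q)

^-cancel-≤ : ∀ q .{{_ : NonZero q}} {i j} → i ℕ.^ q ℕ.≤ j ℕ.^ q → i ℕ.≤ j
^-cancel-≤ q h = ℕ.≮⇒≥ λ j<i → ℕ.<⇒≱ (ℕ.^-monoˡ-< q j<i) h

^-distribʳ-* : ∀ q m n → (m ℕ.* n) ℕ.^ q ≡ m ℕ.^ q ℕ.* n ℕ.^ q
^-distribʳ-* zero m n = refl
^-distribʳ-* (suc q) m n = trans (cong (m ℕ.* n ℕ.*_) (^-distribʳ-* q m n))
  (solve 4 (λ m n x y → m :* n :* (x :* y) := m :* x :* (n :* y)) refl m n (m ℕ.^ q) (n ℕ.^ q))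
  where open +-*-Solver

approx-close : ∀ q .{{_ : NonZero q}} a k l →
               approx q a k ℕ.* suc l ℕ.≤ approx q a l ℕ.* suc k ℕ.+ suc l
approx-close q a k l = begin
  approx q a k ℕ.* L        ≤⟨ ℕ.*-monoˡ-≤ L (⌈root⌉-least q _ j a·Kq≤jq) ⟩
  j ℕ.* L                   ≡⟨ ℕ.+-comm L _ ⟩
  (c ℕ.* K) ℕ./ L ℕ.* L ℕ.+ L ≤⟨ ℕ.+-monoˡ-≤ L (ℕ.m/n*n≤m (c ℕ.* K) L) ⟩
  c ℕ.* K ℕ.+ L             ∎
  where
  open ℕ.≤-Reasoning
  K = suc k
  L = suc l
  c = approx q a l
  j = suc ((c ℕ.* K) ℕ./ L)
  cK≤jL : c ℕ.* K ℕ.≤ j ℕ.* L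
  cK≤jL = begin
    c ℕ.* K                                       ≡⟨ ℕ.m≡m%n+[m/n]*n (c ℕ.* K) L ⟩
    (c ℕ.* K) ℕ.% L ℕ.+ (c ℕ.* K) ℕ./ L ℕ.* L
      ≤⟨ ℕ.+-monoˡ-≤ _ (ℕ.<⇒≤ (ℕ.m%n<n (c ℕ.* K) L)) ⟩
    j ℕ.* L                                       ∎
  a·Kq≤jq : a ℕ.* K ℕ.^ q ℕ.≤ j ℕ.^ q
  a·Kq≤jq = ℕ.*-cancelʳ-≤ _ _ (L ℕ.^ q) {{ℕ.m^n≢0 L q}} (begin
    a ℕ.* K ℕ.^ q ℕ.* L ℕ.^ q
      ≡⟨ solve 3 (λ a x y → a :* x :* y := a :* y :* x) refl a (K ℕ.^ q) (L ℕ.^ q) ⟩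
    a ℕ.* L ℕ.^ q ℕ.* K ℕ.^ q  ≤⟨ ℕ.*-monoˡ-≤ (K ℕ.^ q) (⌈root⌉-upper q (a ℕ.* L ℕ.^ q)) ⟩
    c ℕ.^ q ℕ.* K ℕ.^ q        ≡⟨ ^-distribʳ-* q c K ⟨
    (c ℕ.* K) ℕ.^ q            ≤⟨ ℕ.^-monoˡ-≤ q cK≤jL ⟩
    (j ℕ.* L) ℕ.^ q            ≡⟨ ^-distribʳ-* q j L ⟩
    j ℕ.^ q ℕ.* L ℕ.^ q        ∎)
    where open +-*-Solver

approx-≥ : ∀ q .{{_ : NonZero q}} a .{{_ : NonZero a}} k → suc k ℕ.≤ approx q a k
approx-≥ q a k = ^-cancel-≤ q
  (ℕ.≤-trans (ℕ.m≤n*m (suc k ℕ.^ q) a) (⌈root⌉-upper q (a ℕ.* suc k ℕ.^ q)))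

frac-mono : ∀ c k d l → c ℕ.* suc l ℕ.≤ d ℕ.* suc k → + c ℚ./ suc k ℚ.≤ + d ℚ./ suc l
frac-mono c k d l h = ℚ.toℚᵘ-cancel-≤ (begin
  ℚ.toℚᵘ (+ c ℚ./ suc k)  ≃⟨ ℚ.toℚᵘ-fromℚᵘ (ℚᵘ.mkℚᵘ (+ c) k) ⟩
  ℚᵘ.mkℚᵘ (+ c) k         ≤⟨ ℚᵘ.*≤* (subst₂ ℤ._≤_ (ℤ.pos-* c (suc l)) (ℤ.pos-* d (suc k)) (ℤ.+≤+ h)) ⟩
  ℚᵘ.mkℚᵘ (+ d) l         ≃⟨ ℚ.toℚᵘ-fromℚᵘ (ℚᵘ.mkℚᵘ (+ d) l) ⟨
  ℚ.toℚᵘ (+ d ℚ./ suc l)  ∎)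
  where open ℚᵘ.≤-Reasoning

frac-close : ∀ c k d l → c ℕ.* suc l ℕ.≤ d ℕ.* suc k ℕ.+ suc l →
             + c ℚ./ suc k ℚ.≤ + d ℚ./ suc l ℚ.+ + 1 ℚ./ suc k
frac-close c k d l h = ℚ.toℚᵘ-cancel-≤ (begin
  ℚ.toℚᵘ (+ c ℚ./ suc k)                          ≃⟨ ℚ.toℚᵘ-fromℚᵘ (ℚᵘ.mkℚᵘ (+ c) k) ⟩
  ℚᵘ.mkℚᵘ (+ c) k                                 ≤⟨ ℚᵘ.*≤* (subst₂ ℤ._≤_ eq₁ eq₂ (ℤ.+≤+ h′)) ⟩
  ℚᵘ.mkℚᵘ (+ d) l ℚᵘ.+ ℚᵘ.mkℚᵘ (+ 1) k
    ≃⟨ ℚᵘ.+-cong (ℚ.toℚᵘ-fromℚᵘ (ℚᵘ.mkℚᵘ (+ d) l)) (ℚ.toℚᵘ-fromℚᵘ (ℚᵘ.mkℚᵘ (+ 1) k)) ⟨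
  ℚ.toℚᵘ (+ d ℚ./ suc l) ℚᵘ.+ ℚ.toℚᵘ (+ 1 ℚ./ suc k)
    ≃⟨ ℚ.toℚᵘ-homo-+ (+ d ℚ./ suc l) (+ 1 ℚ./ suc k) ⟨
  ℚ.toℚᵘ (+ d ℚ./ suc l ℚ.+ + 1 ℚ./ suc k)        ∎)
  where
  open ℚᵘ.≤-Reasoning
  h′ : c ℕ.* (suc l ℕ.* suc k) ℕ.≤ (d ℕ.* suc k ℕ.+ 1 ℕ.* suc l) ℕ.* suc k
  h′ = subst₂ ℕ._≤_ (ℕ.*-assoc c (suc l) (suc k))
         (cong (λ t → (d ℕ.* suc k ℕ.+ t) ℕ.* suc k) (sym (ℕ.*-identityˡ (suc l))))
         (ℕ.*-monoˡ-≤ (suc k) h)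
  eq₁ : + (c ℕ.* (suc l ℕ.* suc k)) ≡ + c ℤ.* (+ (suc l ℕ.* suc k))
  eq₁ = ℤ.pos-* c (suc l ℕ.* suc k)
  eq₂ : + ((d ℕ.* suc k ℕ.+ 1 ℕ.* suc l) ℕ.* suc k) ≡
        (+ d ℤ.* + suc k ℤ.+ + 1 ℤ.* + suc l) ℤ.* + suc k
  eq₂ = trans (ℤ.pos-* (d ℕ.* suc k ℕ.+ 1 ℕ.* suc l) (suc k))
          (cong (ℤ._* + suc k) (trans (ℤ.pos-+ (d ℕ.* suc k) (1 ℕ.* suc l))
            (cong₂ ℤ._+_ (ℤ.pos-* d (suc k)) (ℤ.pos-* 1 (suc l)))))

archimedean : ∀ ε → 0ℚ ℚ.< ε → ∃ λ N → + 1 ℚ./ suc N ℚ.≤ ε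
archimedean ε@(mkℚ (ℤ.+[1+ n ]) N c) _ = N ,
  subst (+ 1 ℚ./ suc N ℚ.≤_) (ℚ.fromℚᵘ-toℚᵘ ε)
    (frac-mono 1 N (suc n) N (ℕ.*-monoˡ-≤ (suc N) {1} {suc n} (ℕ.s≤s ℕ.z≤n)))
archimedean (mkℚ (+ zero) N c) (ℚ.*<* (ℤ.+<+ ()))
archimedean (mkℚ -[1+ n ] N c) (ℚ.*<* ())

-- The q-th root of a: the k-th approximation is the least multiple of
-- 1 / (k + 1) whose q-th power is at least a.
root : (q : ℕ) .{{_ : NonZero q}} → ℕ → ℝ
root q a .seq k = + ⌈root⌉ q (a ℕ.* suc k ℕ.^ q) ℚ./ suc k
root q a .cauchy ε 0<ε with archimedean ε 0<ε
... | N , 1/N≤ε = N , λ m n N≤m N≤n → abs-sub≤ (close m n N≤m) (close n m N≤n)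
  where
  close : ∀ k l → N ℕ.≤ k → root q a .seq k ℚ.≤ root q a .seq l ℚ.+ ε
  close k l N≤k = ℚ.≤-trans
    (frac-close (approx q a k) k (approx q a l) l (approx-close q a k l))
    (ℚ.+-monoʳ-≤ (root q a .seq l)
      (ℚ.≤-trans (frac-mono 1 k 1 N (ℕ.*-monoʳ-≤ 1 (ℕ.s≤s N≤k))) 1/N≤ε))

root-positive : ∀ q .{{_ : NonZero q}} a .{{_ : NonZero a}} → Positive (root q a)
root-positive q a .bound = 1ℚ
root-positive q a .bound-pos = ℚ.positive⁻¹ 1ℚ
root-positive q a .from = 0
root-positive q a .bound≤ k _ = frac-mono 1 0 (approx q a k) k
  (subst₂ ℕ._≤_ (sym (ℕ.*-identityˡ (suc k))) (sym (ℕ.*-identityʳ (approx q a k)))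
    (approx-≥ q a k))

-- a to the power z / q, for a positive natural number a
power : (a : ℕ) .{{_ : NonZero a}} → ℤ → (q : ℕ) .{{_ : NonZero q}} → ℝ
power a (+ p)    q = root q (a ℕ.^ p)
power a -[1+ p ] q =
  (root q (a ℕ.^ suc p) ⁻¹) {{root-positive q (a ℕ.^ suc p) {{ℕ.m^n≢0 a (suc p)}}}}

power-positive : ∀ a .{{_ : NonZero a}} z q .{{_ : NonZero q}} → Positive (power a z q)
power-positive a (+ p)    q = root-positive q (a ℕ.^ p) {{ℕ.m^n≢0 a p}}
power-positive a -[1+ p ] q =
  ⁻¹-positive {{root-positive q (a ℕ.^ suc p) {{ℕ.m^n≢0 a (suc p)}}}}

infixr 8 _^_

-- Copatterns keep a ^ e from unfolding, so that instance search can
-- recognise it.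
_^_ : (a : ℕ) .{{_ : NonZero a}} → ℚ → ℝ
(a ^ e) .seq    = seq (power a (ℚ.↥ e) (ℚ.↧ₙ e))
(a ^ e) .cauchy = cauchy (power a (ℚ.↥ e) (ℚ.↧ₙ e))

instance
  ^-positive : ∀ {a} .{{_ : NonZero a}} {e} → Positive (a ^ e)
  ^-positive {a} {e} .bound     = bound (power-positive a (ℚ.↥ e) (ℚ.↧ₙ e))
  ^-positive {a} {e} .bound-pos = bound-pos (power-positive a (ℚ.↥ e) (ℚ.↧ₙ e))
  ^-positive {a} {e} .from      = from (power-positive a (ℚ.↥ e) (ℚ.↧ₙ e))
  ^-positive {a} {e} .bound≤    = bound≤ (power-positive a (ℚ.↥ e) (ℚ.↧ₙ e))

{-# OPTIONS --safe #-}
module Submission where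

-- Let A contain each vertex independently with probability 1 - q. Adding to A
-- the vertices whose closed neighbourhood, in G or in its complement, avoids A
-- yields a global dominating set, so γ_g(G) ≤ (1 - q + 2 q^(δ′+1)) n for every
-- q in [0, 1]. The choice q = (2 (1 + δ′))^(-1/δ′) gives the theorem. As `root`
-- approximates roots by rationals from above, the q computed from the k-th
-- approximations satisfies 2 (1 + δ′) q^δ′ ≤ 1, which is all that is needed:
-- the inequality of reals therefore holds term by term, without a limit.

open import Defs
open import Data.Bool using (Bool; true; false)
open import Data.Fin using (Fin; zero; suc)
open import Data.Fin.Subset using (Subset; inside; outside; _∈_; _⊆_; _∪_; ⁅_⁆; ∣_∣)
open import Data.Fin.Subset.Properties
  using (x∈p∪q⁻; p⊆p∪q; q⊆p∪q; x∈⁅x⁆; x∈⁅y⁆⇒x≡y; p⊂q⇒∣p∣<∣q∣; ⊆-trans)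
open import Data.Integer as ℤ using (+_)
import Data.Integer.Properties as ℤ
import Data.List as List
open import Data.List.Extrema.Nat using (min≤v⁺)
import Data.List.Membership.Propositional as List
open import Data.List.Membership.Propositional.Properties
  using (∈-++⁺ˡ; ∈-++⁺ʳ; ∈-map⁺; ∈-filter⁺; ∈-allFin)
import Data.List.Relation.Unary.Any as Any
open import Data.Nat as ℕ using (ℕ; zero; suc; NonZero; z≤n; s≤s)
open import Data.Nat.Coprimality using (Coprime; coprime-+; 1-coprimeTo)
import Data.Nat.Properties as ℕ
open import Data.Nat.Solver using (module +-*-Solver)
open import Data.Product using (∃; _×_; _,_)
open import Data.Rational as ℚ using (ℚ; mkℚ; 0ℚ; 1ℚ)
import Data.Rational.Properties as ℚ
import Data.Rational.Solver as ℚ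
import Data.Rational.Unnormalised as ℚᵘ
import Data.Rational.Unnormalised.Properties as ℚᵘ
open import Data.Sum using (inj₁; inj₂)
open import Data.Vec using ([]; _∷_; tabulate; here; there)
open import Data.Vec.Properties using ([]=⇒lookup; lookup⇒[]=; lookup∘tabulate)
open import Function using (_∘_)
open import Relation.Binary.PropositionalEquality
open import Relation.Nullary using (yes; contradiction)

-- Minima over subsets and vertices, and the size of a union.

∈-subsets : ∀ {n} (X : Subset n) → X List.∈ subsets n
∈-subsets [] = Any.here refl
∈-subsets (outside ∷ X) = ∈-++⁺ˡ (∈-map⁺ (outside ∷_) (∈-subsets X))
∈-subsets {suc n} (inside ∷ X) =
  ∈-++⁺ʳ (List.map (outside ∷_) (subsets n)) (∈-map⁺ (inside ∷_) (∈-subsets X))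

globalDominationNumber≤ : ∀ {n} (G : Graph n) {X} → GlobalDominating G X →
                          globalDominationNumber G ℕ.≤ ∣ X ∣
globalDominationNumber≤ {n} G {X} dom = min≤v⁺ n _ (inj₂ (List.lose
  (∈-map⁺ ∣_∣ (∈-filter⁺ (globalDominating? G) (∈-subsets X) dom)) ℕ.≤-refl))

minDegree≤degree : ∀ {n} (G : Graph n) v → minDegree G ℕ.≤ degree G v
minDegree≤degree {n} G v =
  min≤v⁺ n _ (inj₂ (List.lose (∈-map⁺ (degree G) (∈-allFin v)) ℕ.≤-refl))

∣p∪q∣≤∣p∣+∣q∣ : ∀ {n} (p q : Subset n) → ∣ p ∪ q ∣ ℕ.≤ ∣ p ∣ ℕ.+ ∣ q ∣
∣p∪q∣≤∣p∣+∣q∣ [] [] = z≤n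
∣p∪q∣≤∣p∣+∣q∣ (outside ∷ p) (outside ∷ q) = ∣p∪q∣≤∣p∣+∣q∣ p q
∣p∪q∣≤∣p∣+∣q∣ (outside ∷ p) (inside ∷ q) =
  ℕ.≤-trans (s≤s (∣p∪q∣≤∣p∣+∣q∣ p q)) (ℕ.≤-reflexive (sym (ℕ.+-suc ∣ p ∣ ∣ q ∣)))
∣p∪q∣≤∣p∣+∣q∣ (inside ∷ p) (outside ∷ q) = s≤s (∣p∪q∣≤∣p∣+∣q∣ p q)
∣p∪q∣≤∣p∣+∣q∣ (inside ∷ p) (inside ∷ q) =
  s≤s (ℕ.≤-trans (∣p∪q∣≤∣p∣+∣q∣ p q) (ℕ.+-monoʳ-≤ ∣ p ∣ (ℕ.n≤1+n ∣ q ∣)))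

-- Undominated vertices and repaired dominating sets.

∈-tabulate⁺ : ∀ {n} {f : Fin n → Bool} {v} → f v ≡ true → v ∈ tabulate f
∈-tabulate⁺ {f = f} {v} fv = lookup⇒[]= v (tabulate f) (trans (lookup∘tabulate f v) fv)

∈-tabulate⁻ : ∀ {n} {f : Fin n → Bool} {v} → v ∈ tabulate f → f v ≡ true
∈-tabulate⁻ {f = f} {v} v∈ = trans (sym (lookup∘tabulate f v)) ([]=⇒lookup v∈)

-- Disjointness as a Boolean, so that it can both define a subset by `tabulate` and serve as the
-- indicator of an event. It recurses on both sets at once, in step with the recursion of `E`.
avoids : ∀ {n} → Subset n → Subset n → Bool
avoids [] [] = true
avoids (outside ∷ S) (_ ∷ A) = avoids S A
avoids (inside ∷ S) (outside ∷ A) = avoids S A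
avoids (inside ∷ S) (inside ∷ A) = false

¬avoids⇒meets : ∀ {n} (S A : Subset n) → avoids S A ≡ false → ∃ λ u → u ∈ S × u ∈ A
¬avoids⇒meets [] [] ()
¬avoids⇒meets (outside ∷ S) (_ ∷ A) h with u , u∈S , u∈A ← ¬avoids⇒meets S A h =
  suc u , there u∈S , there u∈A
¬avoids⇒meets (inside ∷ S) (outside ∷ A) h with u , u∈S , u∈A ← ¬avoids⇒meets S A h =
  suc u , there u∈S , there u∈A
¬avoids⇒meets (inside ∷ S) (inside ∷ A) _ = zero , here , here

module _ {n} (G : Graph n) where

  closedNeighbourhood : Fin n → Subset n
  closedNeighbourhood v = neighbourhood G v ∪ ⁅ v ⁆

  ∈neighbourhood⇒adj : ∀ {v u} → u ∈ neighbourhood G v → Adj G v u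
  ∈neighbourhood⇒adj {v} {u} u∈N with adj? G v u | ∈-tabulate⁻ u∈N
  ... | yes a | _ = a

  -- Irreflexivity makes `v` a new element. This one extra vertex is the source of the exponent δ′ +
  -- 1, rather than δ′, in the probability of being undominated.
  degree<∣closedNeighbourhood∣ : ∀ v → degree G v ℕ.< ∣ closedNeighbourhood v ∣
  degree<∣closedNeighbourhood∣ v = p⊂q⇒∣p∣<∣q∣
    (p⊆p∪q ⁅ v ⁆ , v , q⊆p∪q (neighbourhood G v) ⁅ v ⁆ (x∈⁅x⁆ v) ,
     λ v∈N → irrefl G refl (∈neighbourhood⇒adj v∈N))

  undominated : Subset n → Subset n
  undominated A = tabulate λ v → avoids (closedNeighbourhood v) A

  -- A vertex `v` outside `X` is not undominated, so its closed neighbourhood meets `A`. The common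
  -- vertex cannot be `v`, since `A` lies inside `X`; hence it is a neighbour of `v`.
  dominating-⊇ : ∀ {A X} → A ⊆ X → undominated A ⊆ X → Dominating G X
  dominating-⊇ {A} A⊆X U⊆X v v∉X with avoids (closedNeighbourhood v) A in eq
  ... | true  = contradiction (U⊆X (∈-tabulate⁺ eq)) v∉X
  ... | false with u , u∈S , u∈A ← ¬avoids⇒meets (closedNeighbourhood v) A eq
              with x∈p∪q⁻ (neighbourhood G v) ⁅ v ⁆ u∈S
  ...   | inj₁ u∈N = u , A⊆X u∈A , ∈neighbourhood⇒adj u∈N
  ...   | inj₂ u∈v = contradiction (subst (_∈ _) (x∈⁅y⁆⇒x≡y v u∈v) (A⊆X u∈A)) v∉X

globalDominationNumber≤∣A∣+undominated : ∀ {n} (G : Graph n) A →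
  globalDominationNumber G ℕ.≤
    ∣ A ∣ ℕ.+ (∣ undominated G A ∣ ℕ.+ ∣ undominated (complement G) A ∣)
globalDominationNumber≤∣A∣+undominated G A = begin
  globalDominationNumber G ≤⟨ globalDominationNumber≤ G
    ( dominating-⊇ G (p⊆p∪q (U ∪ Ū)) (⊆-trans (p⊆p∪q Ū) (q⊆p∪q A (U ∪ Ū)))
    , dominating-⊇ (complement G) (p⊆p∪q (U ∪ Ū)) (⊆-trans (q⊆p∪q U Ū) (q⊆p∪q A (U ∪ Ū))) ) ⟩
  ∣ A ∪ (U ∪ Ū) ∣           ≤⟨ ∣p∪q∣≤∣p∣+∣q∣ A (U ∪ Ū) ⟩
  ∣ A ∣ ℕ.+ ∣ U ∪ Ū ∣       ≤⟨ ℕ.+-monoʳ-≤ ∣ A ∣ (∣p∪q∣≤∣p∣+∣q∣ U Ū) ⟩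
  ∣ A ∣ ℕ.+ (∣ U ∣ ℕ.+ ∣ Ū ∣) ∎
  where
  open ℕ.≤-Reasoning
  U = undominated G A
  Ū = undominated (complement G) A

-- Expectation over a random subset.

⟦_⟧ : Bool → ℕ
⟦ true  ⟧ = 1
⟦ false ⟧ = 0

∣b∷p∣ : ∀ {n} b (p : Subset n) → ∣ b ∷ p ∣ ≡ ⟦ b ⟧ ℕ.+ ∣ p ∣
∣b∷p∣ true  p = refl
∣b∷p∣ false p = refl

-- A vertex is left out with probability q = s / t. All statements are multiplied by powers of `t`,
-- so that only natural numbers occur.
module WeightedSum (r s : ℕ) where

  open ℕ.≤-Reasoning
  open +-*-Solver using (solve; _:+_; _:*_; _:=_; con)

  t : ℕ
  t = r ℕ.+ s

  -- (r + s)ⁿ times the expectation of f over a random subset that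
  -- contains each vertex independently with probability r / (r + s).
  E : ∀ {n} → (Subset n → ℕ) → ℕ
  E {zero}  f = f []
  E {suc n} f = r ℕ.* E (f ∘ (inside ∷_)) ℕ.+ s ℕ.* E (f ∘ (outside ∷_))

  E-mono : ∀ {n} {f g : Subset n → ℕ} → (∀ A → f A ℕ.≤ g A) → E f ℕ.≤ E g
  E-mono {zero}  f≤g = f≤g []
  E-mono {suc n} f≤g = ℕ.+-mono-≤ (ℕ.*-monoʳ-≤ r (E-mono (f≤g ∘ (inside ∷_))))
                                  (ℕ.*-monoʳ-≤ s (E-mono (f≤g ∘ (outside ∷_))))

  E-cong : ∀ {n} {f g : Subset n → ℕ} → (∀ A → f A ≡ g A) → E f ≡ E g
  E-cong f≡g = ℕ.≤-antisym (E-mono (ℕ.≤-reflexive ∘ f≡g)) (E-mono (ℕ.≤-reflexive ∘ sym ∘ f≡g))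

  E-+ : ∀ {n} (f g : Subset n → ℕ) → E (λ A → f A ℕ.+ g A) ≡ E f ℕ.+ E g
  E-+ {zero}  f g = refl
  E-+ {suc n} f g = trans
    (cong₂ (λ x y → r ℕ.* x ℕ.+ s ℕ.* y) (E-+ (f ∘ (inside ∷_)) (g ∘ (inside ∷_)))
                                         (E-+ (f ∘ (outside ∷_)) (g ∘ (outside ∷_))))
    (solve 6 (λ r s a b c d → r :* (a :+ b) :+ s :* (c :+ d) :=
                              r :* a :+ s :* c :+ (r :* b :+ s :* d)) refl
       r s (E (f ∘ (inside ∷_))) (E (g ∘ (inside ∷_)))
           (E (f ∘ (outside ∷_))) (E (g ∘ (outside ∷_))))

  E-const : ∀ n c → E {n} (λ _ → c) ≡ c ℕ.* t ℕ.^ n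
  E-const zero    c = sym (ℕ.*-identityʳ c)
  E-const (suc n) c = trans
    (cong (λ e → r ℕ.* e ℕ.+ s ℕ.* e) (E-const n c))
    (solve 4 (λ r s c x → r :* (c :* x) :+ s :* (c :* x) := c :* ((r :+ s) :* x)) refl
       r s c (t ℕ.^ n))

  -- The expected size is n r / t. The factor `t` on the left avoids the division and the exponent n
  -- - 1.
  E-size : ∀ n → t ℕ.* E {n} ∣_∣ ≡ n ℕ.* r ℕ.* t ℕ.^ n
  E-size zero    = ℕ.*-zeroʳ t
  E-size (suc n) = begin-equality
    t ℕ.* (r ℕ.* E {n} (λ A → suc ∣ A ∣) ℕ.+ s ℕ.* e)
      ≡⟨ cong (λ x → t ℕ.* (r ℕ.* x ℕ.+ s ℕ.* e))
           (trans (E-+ {n} (λ _ → 1) ∣_∣) (cong (ℕ._+ e) (E-const n 1))) ⟩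
    t ℕ.* (r ℕ.* (1 ℕ.* T ℕ.+ e) ℕ.+ s ℕ.* e)
      ≡⟨ solve 4 (λ r s T e → (r :+ s) :* (r :* (con 1 :* T :+ e) :+ s :* e) :=
           (r :+ s) :* (r :* T :+ (r :+ s) :* e)) refl r s T e ⟩
    t ℕ.* (r ℕ.* T ℕ.+ t ℕ.* e)
      ≡⟨ cong (λ x → t ℕ.* (r ℕ.* T ℕ.+ x)) (E-size n) ⟩
    t ℕ.* (r ℕ.* T ℕ.+ n ℕ.* r ℕ.* T)
      ≡⟨ solve 4 (λ r t n T → t :* (r :* T :+ n :* r :* T) :=
           (con 1 :+ n) :* r :* (t :* T)) refl r t n T ⟩
    suc n ℕ.* r ℕ.* (t ℕ.* T) ∎
    where
    e = E {n} ∣_∣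
    T = t ℕ.^ n

  -- The random set avoids `S` with probability q^|S|, which is at most q^j. In the induction a
  -- vertex outside `S` contributes r + s = t, while a vertex of `S` must be left out and
  -- contributes only `s`.
  E-avoids : ∀ {n} (S : Subset n) {j} → j ℕ.≤ ∣ S ∣ →
             t ℕ.^ j ℕ.* E (⟦_⟧ ∘ avoids S) ℕ.≤ s ℕ.^ j ℕ.* t ℕ.^ n
  E-avoids [] z≤n = ℕ.≤-refl
  E-avoids {suc n} (outside ∷ S) {j} j≤ = begin
    t ℕ.^ j ℕ.* (r ℕ.* e ℕ.+ s ℕ.* e)
      ≡⟨ solve 4 (λ r s x e → x :* (r :* e :+ s :* e) := (r :+ s) :* (x :* e)) refl
           r s (t ℕ.^ j) e ⟩
    t ℕ.* (t ℕ.^ j ℕ.* e)          ≤⟨ ℕ.*-monoʳ-≤ t (E-avoids S j≤) ⟩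
    t ℕ.* (s ℕ.^ j ℕ.* t ℕ.^ n)
      ≡⟨ solve 3 (λ t x y → t :* (x :* y) := x :* (t :* y)) refl t (s ℕ.^ j) (t ℕ.^ n) ⟩
    s ℕ.^ j ℕ.* (t ℕ.* t ℕ.^ n)    ∎
    where e = E (⟦_⟧ ∘ avoids S)
  -- All `j` factors of q are already used, so the factor `s` of this vertex is only estimated by
  -- `t`.
  E-avoids {suc n} (inside ∷ S) {zero} _ = begin
    1 ℕ.* (r ℕ.* E {n} (λ _ → 0) ℕ.+ s ℕ.* e)
      ≡⟨ cong (λ x → 1 ℕ.* (r ℕ.* x ℕ.+ s ℕ.* e)) (E-const n 0) ⟩
    1 ℕ.* (r ℕ.* 0 ℕ.+ s ℕ.* e)
      ≡⟨ solve 3 (λ r s e → con 1 :* (r :* con 0 :+ s :* e) := s :* (con 1 :* e)) refl r s e ⟩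
    s ℕ.* (1 ℕ.* e)                 ≤⟨ ℕ.*-mono-≤ (ℕ.m≤n+m s r) (E-avoids S z≤n) ⟩
    t ℕ.* (1 ℕ.* t ℕ.^ n)
      ≡⟨ solve 2 (λ t x → t :* (con 1 :* x) := con 1 :* (t :* x)) refl t (t ℕ.^ n) ⟩
    1 ℕ.* (t ℕ.* t ℕ.^ n)           ∎
    where e = E (⟦_⟧ ∘ avoids S)
  E-avoids {suc n} (inside ∷ S) {suc j} (s≤s j≤) = begin
    t ℕ.* t ℕ.^ j ℕ.* (r ℕ.* E {n} (λ _ → 0) ℕ.+ s ℕ.* e)
      ≡⟨ cong (λ x → t ℕ.* t ℕ.^ j ℕ.* (r ℕ.* x ℕ.+ s ℕ.* e)) (E-const n 0) ⟩
    t ℕ.* t ℕ.^ j ℕ.* (r ℕ.* 0 ℕ.+ s ℕ.* e)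
      ≡⟨ solve 5 (λ r s t x e → t :* x :* (r :* con 0 :+ s :* e) := s :* t :* (x :* e)) refl
           r s t (t ℕ.^ j) e ⟩
    s ℕ.* t ℕ.* (t ℕ.^ j ℕ.* e)     ≤⟨ ℕ.*-monoʳ-≤ (s ℕ.* t) (E-avoids S j≤) ⟩
    s ℕ.* t ℕ.* (s ℕ.^ j ℕ.* t ℕ.^ n)
      ≡⟨ solve 4 (λ s t x y → s :* t :* (x :* y) := s :* x :* (t :* y)) refl
           s t (s ℕ.^ j) (t ℕ.^ n) ⟩
    s ℕ.* s ℕ.^ j ℕ.* (t ℕ.* t ℕ.^ n) ∎
    where e = E (⟦_⟧ ∘ avoids S)

  -- Linearity of expectation: the size of a random set is the sum of the indicators of its possible
  -- elements. The multiplier `c` carries the denominators of the bound on each probability.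
  E-∣tabulate∣ : ∀ {m n} (P : Fin m → Subset n → Bool) c {b} →
                 (∀ v → c ℕ.* E (⟦_⟧ ∘ P v) ℕ.≤ b) →
                 c ℕ.* E (λ A → ∣ tabulate (λ v → P v A) ∣) ℕ.≤ m ℕ.* b
  E-∣tabulate∣ {zero} {n} P c _ =
    ℕ.≤-reflexive (trans (cong (c ℕ.*_) (E-const n 0)) (ℕ.*-zeroʳ c))
  E-∣tabulate∣ {suc m} P c {b} h = begin
    c ℕ.* E (λ A → ∣ P zero A ∷ rest A ∣)
      ≡⟨ cong (c ℕ.*_) (E-cong λ A → ∣b∷p∣ (P zero A) (rest A)) ⟩
    c ℕ.* E (λ A → ⟦ P zero A ⟧ ℕ.+ ∣ rest A ∣)
      ≡⟨ cong (c ℕ.*_) (E-+ (⟦_⟧ ∘ P zero) (∣_∣ ∘ rest)) ⟩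
    c ℕ.* (E (⟦_⟧ ∘ P zero) ℕ.+ E (∣_∣ ∘ rest))
      ≡⟨ ℕ.*-distribˡ-+ c _ _ ⟩
    c ℕ.* E (⟦_⟧ ∘ P zero) ℕ.+ c ℕ.* E (∣_∣ ∘ rest)
      ≤⟨ ℕ.+-mono-≤ (h zero) (E-∣tabulate∣ (P ∘ suc) c (h ∘ suc)) ⟩
    b ℕ.+ m ℕ.* b ∎
    where
    rest = λ A → tabulate (λ v → P (suc v) A)

  E-undominated : ∀ {n} (G : Graph n) {d} → (∀ v → d ℕ.≤ degree G v) →
                  t ℕ.^ suc d ℕ.* E (∣_∣ ∘ undominated G) ℕ.≤ n ℕ.* (s ℕ.^ suc d ℕ.* t ℕ.^ n)
  E-undominated G {d} d≤ = E-∣tabulate∣ (avoids ∘ closedNeighbourhood G) (t ℕ.^ suc d) λ v →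
    E-avoids (closedNeighbourhood G v) (ℕ.≤-<-trans (d≤ v) (degree<∣closedNeighbourhood∣ G v))

  -- This is γ ≤ (1 - q + 2 q^(d+1)) n multiplied by t^(d+1). The constant γ is its own average, so
  -- it is at most the average size of the repaired set; the common factor t^n is cancelled.
  expectation-bound : .{{_ : NonZero t}} → ∀ {n} (G : Graph n) {d} →
    (∀ v → d ℕ.≤ degree G v) → (∀ v → d ℕ.≤ degree (complement G) v) →
    globalDominationNumber G ℕ.* t ℕ.^ suc d ℕ.≤
      n ℕ.* (r ℕ.* t ℕ.^ d ℕ.+ 2 ℕ.* s ℕ.^ suc d)
  expectation-bound {n} G {d} d≤ d≤̄ = ℕ.*-cancelʳ-≤ _ _ T {{ℕ.m^n≢0 t n}} (begin
    γ ℕ.* (t ℕ.* D) ℕ.* T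
      ≡⟨ solve 4 (λ γ t D T → γ :* (t :* D) :* T := t :* D :* (γ :* T)) refl γ t D T ⟩
    t ℕ.* D ℕ.* (γ ℕ.* T)
      ≡⟨ cong (t ℕ.* D ℕ.*_) (E-const n γ) ⟨
    t ℕ.* D ℕ.* E (λ (_ : Subset n) → γ)
      ≤⟨ ℕ.*-monoʳ-≤ (t ℕ.* D) (E-mono (globalDominationNumber≤∣A∣+undominated G)) ⟩
    t ℕ.* D ℕ.* E (λ A → ∣ A ∣ ℕ.+ (u A ℕ.+ ū A))
      ≡⟨ cong (t ℕ.* D ℕ.*_) (trans (E-+ {n} ∣_∣ _) (cong (E {n} ∣_∣ ℕ.+_) (E-+ u ū))) ⟩
    t ℕ.* D ℕ.* (E {n} ∣_∣ ℕ.+ (E u ℕ.+ E ū))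
      ≡⟨ solve 5 (λ t D a b c → t :* D :* (a :+ (b :+ c)) :=
           D :* (t :* a) :+ (t :* D :* b :+ t :* D :* c)) refl t D (E {n} ∣_∣) (E u) (E ū) ⟩
    D ℕ.* (t ℕ.* E {n} ∣_∣) ℕ.+ (t ℕ.* D ℕ.* E u ℕ.+ t ℕ.* D ℕ.* E ū)
      ≤⟨ ℕ.+-mono-≤ (ℕ.≤-reflexive (cong (D ℕ.*_) (E-size n)))
           (ℕ.+-mono-≤ (E-undominated G d≤) (E-undominated (complement G) d≤̄)) ⟩
    D ℕ.* (n ℕ.* r ℕ.* T) ℕ.+ (n ℕ.* (S ℕ.* T) ℕ.+ n ℕ.* (S ℕ.* T))
      ≡⟨ solve 5 (λ n r D S T → D :* (n :* r :* T) :+ (n :* (S :* T) :+ n :* (S :* T)) :=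
           n :* (r :* D :+ con 2 :* S) :* T) refl n r D S T ⟩
    n ℕ.* (r ℕ.* D ℕ.+ 2 ℕ.* S) ℕ.* T ∎)
    where
    γ = globalDominationNumber G
    T = t ℕ.^ n
    D = t ℕ.^ d
    S = s ℕ.^ suc d
    u = ∣_∣ ∘ undominated G
    ū = ∣_∣ ∘ undominated (complement G)

-- Substituting the chosen q.

-- The hypothesis `root` says 2 (1 + d) q^d ≤ 1, so 2 q^(d+1) ≤ q / (1 + d). The bound 1 - q + 2
-- q^(d+1) thus becomes at most 1 - d q / (1 + d).
expectation-at-optimum : ∀ d γ n r s .{{_ : NonZero (r ℕ.+ s)}} →
  γ ℕ.* (r ℕ.+ s) ℕ.^ suc d ℕ.≤ n ℕ.* (r ℕ.* (r ℕ.+ s) ℕ.^ d ℕ.+ 2 ℕ.* s ℕ.^ suc d) →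
  2 ℕ.* (suc d ℕ.* s ℕ.^ d) ℕ.≤ (r ℕ.+ s) ℕ.^ d →
  suc d ℕ.* (γ ℕ.* (r ℕ.+ s)) ℕ.+ n ℕ.* (d ℕ.* s) ℕ.≤ suc d ℕ.* (n ℕ.* (r ℕ.+ s))
expectation-at-optimum d γ n r s expected root = begin
  suc d ℕ.* (γ ℕ.* t) ℕ.+ n ℕ.* (d ℕ.* s)
    ≤⟨ ℕ.+-monoˡ-≤ (n ℕ.* (d ℕ.* s)) (ℕ.*-cancelʳ-≤ _ _ D {{ℕ.m^n≢0 t d}} scaled) ⟩
  n ℕ.* (suc d ℕ.* r ℕ.+ s) ℕ.+ n ℕ.* (d ℕ.* s)
    ≡⟨ solve 4 (λ d n r s → n :* ((con 1 :+ d) :* r :+ s) :+ n :* (d :* s) :=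
         (con 1 :+ d) :* (n :* (r :+ s))) refl d n r s ⟩
  suc d ℕ.* (n ℕ.* t) ∎
  where
  open ℕ.≤-Reasoning
  open +-*-Solver using (solve; _:+_; _:*_; _:=_; con)
  t = r ℕ.+ s
  D = t ℕ.^ d
  scaled : suc d ℕ.* (γ ℕ.* t) ℕ.* D ℕ.≤ n ℕ.* (suc d ℕ.* r ℕ.+ s) ℕ.* D
  scaled = begin
    suc d ℕ.* (γ ℕ.* t) ℕ.* D
      ≡⟨ solve 4 (λ d γ t D → d :* (γ :* t) :* D := d :* (γ :* (t :* D))) refl (suc d) γ t D ⟩
    suc d ℕ.* (γ ℕ.* (t ℕ.* D))
      ≤⟨ ℕ.*-monoʳ-≤ (suc d) expected ⟩
    suc d ℕ.* (n ℕ.* (r ℕ.* D ℕ.+ 2 ℕ.* (s ℕ.* s ℕ.^ d)))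
      ≡⟨ solve 6 (λ d n r s D S → d :* (n :* (r :* D :+ con 2 :* (s :* S))) :=
           n :* (d :* r :* D :+ s :* (con 2 :* (d :* S)))) refl (suc d) n r s D (s ℕ.^ d) ⟩
    n ℕ.* (suc d ℕ.* r ℕ.* D ℕ.+ s ℕ.* (2 ℕ.* (suc d ℕ.* s ℕ.^ d)))
      ≤⟨ ℕ.*-monoʳ-≤ n (ℕ.+-monoʳ-≤ (suc d ℕ.* r ℕ.* D) (ℕ.*-monoʳ-≤ s root)) ⟩
    n ℕ.* (suc d ℕ.* r ℕ.* D ℕ.+ s ℕ.* D)
      ≡⟨ solve 5 (λ d n r s D → n :* (d :* r :* D :+ s :* D) :=
           n :* (d :* r :+ s) :* D) refl (suc d) n r s D ⟩
    n ℕ.* (suc d ℕ.* r ℕ.+ s) ℕ.* D ∎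

-- From natural numbers to rationals.

-- On unnormalised fractions equality is a cross-multiplication, so identities are checked there
-- without computing any gcd.
fromℚᵘ-+ : ∀ p q r → p ℚᵘ.+ q ℚᵘ.≃ r → ℚ.fromℚᵘ p ℚ.+ ℚ.fromℚᵘ q ≡ ℚ.fromℚᵘ r
fromℚᵘ-+ p q r eq = ℚ.toℚᵘ-injective (begin-equality
  ℚ.toℚᵘ (ℚ.fromℚᵘ p ℚ.+ ℚ.fromℚᵘ q)            ≃⟨ ℚ.toℚᵘ-homo-+ (ℚ.fromℚᵘ p) (ℚ.fromℚᵘ q) ⟩
  ℚ.toℚᵘ (ℚ.fromℚᵘ p) ℚᵘ.+ ℚ.toℚᵘ (ℚ.fromℚᵘ q)  ≃⟨ ℚᵘ.+-cong (ℚ.toℚᵘ-fromℚᵘ p) (ℚ.toℚᵘ-fromℚᵘ q) ⟩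
  p ℚᵘ.+ q                                      ≃⟨ eq ⟩
  r                                             ≃⟨ ℚ.toℚᵘ-fromℚᵘ r ⟨
  ℚ.toℚᵘ (ℚ.fromℚᵘ r)                           ∎)
  where open ℚᵘ.≤-Reasoning

fromℚᵘ-* : ∀ p q r → p ℚᵘ.* q ℚᵘ.≃ r → ℚ.fromℚᵘ p ℚ.* ℚ.fromℚᵘ q ≡ ℚ.fromℚᵘ r
fromℚᵘ-* p q r eq = ℚ.toℚᵘ-injective (begin-equality
  ℚ.toℚᵘ (ℚ.fromℚᵘ p ℚ.* ℚ.fromℚᵘ q)            ≃⟨ ℚ.toℚᵘ-homo-* (ℚ.fromℚᵘ p) (ℚ.fromℚᵘ q) ⟩
  ℚ.toℚᵘ (ℚ.fromℚᵘ p) ℚᵘ.* ℚ.toℚᵘ (ℚ.fromℚᵘ q)  ≃⟨ ℚᵘ.*-cong (ℚ.toℚᵘ-fromℚᵘ p) (ℚ.toℚᵘ-fromℚᵘ q) ⟩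
  p ℚᵘ.* q                                      ≃⟨ eq ⟩
  r                                             ≃⟨ ℚ.toℚᵘ-fromℚᵘ r ⟨
  ℚ.toℚᵘ (ℚ.fromℚᵘ r)                           ∎)
  where open ℚᵘ.≤-Reasoning

-- The constant term of the sequence `fromℕ m`.
ι : ℕ → ℚ
ι m = + m ℚ./ 1

ι-+ : ∀ a b → ι a ℚ.+ ι b ≡ ι (a ℕ.+ b)
ι-+ a b = fromℚᵘ-+ (ℚᵘ.mkℚᵘ (+ a) 0) (ℚᵘ.mkℚᵘ (+ b) 0) (ℚᵘ.mkℚᵘ (+ (a ℕ.+ b)) 0)
  (ℚᵘ.*≡* (cong (ℤ._* + 1) (cong₂ ℤ._+_ (ℤ.*-identityʳ (+ a)) (ℤ.*-identityʳ (+ b)))))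

ι-* : ∀ a b → ι a ℚ.* ι b ≡ ι (a ℕ.* b)
ι-* a b = fromℚᵘ-* (ℚᵘ.mkℚᵘ (+ a) 0) (ℚᵘ.mkℚᵘ (+ b) 0) (ℚᵘ.mkℚᵘ (+ (a ℕ.* b)) 0)
  (ℚᵘ.*≡* (cong (ℤ._* + 1) (sym (ℤ.pos-* a b))))

/-*-cancel : ∀ c k → (+ c ℚ./ suc k) ℚ.* ι (suc k) ≡ ι c
/-*-cancel c k = fromℚᵘ-* (ℚᵘ.mkℚᵘ (+ c) k) (ℚᵘ.mkℚᵘ (+ suc k) 0) (ℚᵘ.mkℚᵘ (+ c) 0)
  (ℚᵘ.*≡* (trans (ℤ.*-identityʳ (+ c ℤ.* + suc k))
    (cong (λ m → + c ℤ.* + m) (sym (ℕ.*-identityʳ (suc k))))))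

0</ : ∀ c .{{_ : NonZero c}} d .{{_ : NonZero d}} → 0ℚ ℚ.< + c ℚ./ d
0</ c d = ℚ.positive⁻¹ _ {{ℚ.normalize-pos c d}}

-- With K = `suc k`, x = c / K and y = e / K, dividing the hypothesis by c e gives γ + n d / (x y) ≤
-- n, because K² / (c e) = 1 / (x y).
ratio-bound : ∀ γ n d c .{{_ : NonZero c}} e .{{_ : NonZero e}} k →
  γ ℕ.* (c ℕ.* e) ℕ.+ n ℕ.* (d ℕ.* (suc k ℕ.* suc k)) ℕ.≤ n ℕ.* (c ℕ.* e) →
  ι γ ℚ.≤ (1ℚ ℚ.- ι d ℚ.* recip ((+ c ℚ./ suc k) ℚ.* (+ e ℚ./ suc k))) ℚ.* ι n
-- Both sides are multiplied by Q = x y K², which equals c e; writing it through x y lets `recip P`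
-- cancel.
ratio-bound γ n d c e k h = ℚ.*-cancelʳ-≤-pos Q {{ℚ.positive 0<Q}} (begin
  ι γ ℚ.* Q
    ≡⟨ solve 2 (λ a b → a := a :+ b :- b) refl (ι γ ℚ.* Q) (ι n ℚ.* (ι d ℚ.* (κ ℚ.* κ))) ⟩
  ι γ ℚ.* Q ℚ.+ ι n ℚ.* (ι d ℚ.* (κ ℚ.* κ)) ℚ.- ι n ℚ.* (ι d ℚ.* (κ ℚ.* κ))
    ≤⟨ ℚ.+-monoˡ-≤ (ℚ.- (ι n ℚ.* (ι d ℚ.* (κ ℚ.* κ)))) h′ ⟩
  ι n ℚ.* Q ℚ.- ι n ℚ.* (ι d ℚ.* (κ ℚ.* κ))
    ≡⟨ cong (λ z → ι n ℚ.* Q ℚ.- ι n ℚ.* (ι d ℚ.* z))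
         (trans (cong (ℚ._* (κ ℚ.* κ)) (*-recip 0<P)) (ℚ.*-identityˡ (κ ℚ.* κ))) ⟨
  ι n ℚ.* Q ℚ.- ι n ℚ.* (ι d ℚ.* (P ℚ.* recip P ℚ.* (κ ℚ.* κ)))
    ≡⟨ solve 5 (λ n d P R κ →
         n :* (P :* (κ :* κ)) :- n :* (d :* (P :* R :* (κ :* κ))) :=
         (con 1ℚ :- d :* R) :* n :* (P :* (κ :* κ))) refl (ι n) (ι d) P (recip P) κ ⟩
  (1ℚ ℚ.- ι d ℚ.* recip P) ℚ.* ι n ℚ.* Q ∎)
  where
  open ℚ.≤-Reasoning
  open ℚ.+-*-Solver using (solve; _:+_; _:*_; _:-_; _:=_; con)
  x = + c ℚ./ suc k
  y = + e ℚ./ suc k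
  κ = ι (suc k)
  P = x ℚ.* y
  Q = P ℚ.* (κ ℚ.* κ)
  0<P = *-pos (0</ c (suc k)) (0</ e (suc k))
  0<Q = *-pos 0<P (*-pos (0</ (suc k) 1) (0</ (suc k) 1))
  Q≡ce : Q ≡ ι (c ℕ.* e)
  Q≡ce = trans (solve 3 (λ x y κ → x :* y :* (κ :* κ) := x :* κ :* (y :* κ)) refl x y κ)
        (trans (cong₂ ℚ._*_ (/-*-cancel c k) (/-*-cancel e k)) (ι-* c e))
  lhs : ι (γ ℕ.* (c ℕ.* e) ℕ.+ n ℕ.* (d ℕ.* (suc k ℕ.* suc k))) ≡
        ι γ ℚ.* Q ℚ.+ ι n ℚ.* (ι d ℚ.* (κ ℚ.* κ))
  lhs = trans (sym (ι-+ (γ ℕ.* (c ℕ.* e)) (n ℕ.* (d ℕ.* (suc k ℕ.* suc k))))) (cong₂ ℚ._+_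
    (trans (sym (ι-* γ (c ℕ.* e))) (cong (ι γ ℚ.*_) (sym Q≡ce)))
    (trans (sym (ι-* n (d ℕ.* (suc k ℕ.* suc k)))) (cong (ι n ℚ.*_)
      (trans (sym (ι-* d (suc k ℕ.* suc k))) (cong (ι d ℚ.*_) (sym (ι-* (suc k) (suc k))))))))
  rhs : ι (n ℕ.* (c ℕ.* e)) ≡ ι n ℚ.* Q
  rhs = trans (sym (ι-* n (c ℕ.* e))) (cong (ι n ℚ.*_) (sym Q≡ce))
  h′ : ι γ ℚ.* Q ℚ.+ ι n ℚ.* (ι d ℚ.* (κ ℚ.* κ)) ℚ.≤ ι n ℚ.* Q
  h′ = subst₂ ℚ._≤_ lhs rhs
    (frac-mono (γ ℕ.* (c ℕ.* e) ℕ.+ n ℕ.* (d ℕ.* (suc k ℕ.* suc k))) 0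
               (n ℕ.* (c ℕ.* e)) 0 (ℕ.*-monoˡ-≤ 1 h))

-- Exponents of the theorem and their root approximations.

-- The exponents of the theorem are sums and quotients whose normal forms do not compute for a
-- variable denominator. Once an equation supplies the reduced fraction, the power unfolds to a
-- root.
^-seq : ∀ a .{{_ : NonZero a}} {e p q} .{c : Coprime p (suc q)} → e ≡ mkℚ (+ p) q c →
        ∀ k → seq (a ^ e) k ≡ + approx (suc q) (a ℕ.^ p) k ℚ./ suc k
^-seq a refl k = refl

1/d≡ : ∀ d → + 1 ℚ./ suc d ≡ mkℚ (+ 1) d (1-coprimeTo (suc d))
1/d≡ d = ℚ.normalize-coprime (1-coprimeTo (suc d))

2+d-coprimeTo-1+d : ∀ d → Coprime (2 ℕ.+ d) (suc d)
2+d-coprimeTo-1+d d =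
  subst (λ m → Coprime m (suc d)) (ℕ.+-comm (suc d) 1) (coprime-+ (1-coprimeTo (suc d)))

-- Here δ′ is `suc d`. As the fraction is in lowest terms, this exponent has the same denominator δ′
-- as 1 / δ′, and both powers are δ′-th roots.
1+1/d≡ : ∀ d → 1ℚ ℚ.+ + 1 ℚ./ suc d ≡ mkℚ (+ (2 ℕ.+ d)) d (2+d-coprimeTo-1+d d)
1+1/d≡ d = begin
  1ℚ ℚ.+ + 1 ℚ./ suc d
    ≡⟨ fromℚᵘ-+ (ℚᵘ.mkℚᵘ (+ 1) 0) (ℚᵘ.mkℚᵘ (+ 1) d) (ℚᵘ.mkℚᵘ (+ (2 ℕ.+ d)) d)
         (ℚᵘ.*≡* (cong +_ eq)) ⟩
  + (2 ℕ.+ d) ℚ./ suc d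
    ≡⟨ ℚ.normalize-coprime (2+d-coprimeTo-1+d d) ⟩
  mkℚ (+ (2 ℕ.+ d)) d (2+d-coprimeTo-1+d d) ∎
  where
  open ≡-Reasoning
  open +-*-Solver using (solve; _:+_; _:*_; _:=_; con)
  eq : (1 ℕ.* suc d ℕ.+ 1) ℕ.* suc d ≡ (2 ℕ.+ d) ℕ.* (1 ℕ.* suc d)
  eq = solve 1 (λ d → (con 1 :* (con 1 :+ d) :+ con 1) :* (con 1 :+ d) :=
                      (con 2 :+ d) :* (con 1 :* (con 1 :+ d))) refl d

-- For positive `d` the hypotheses say c / K ≥ 2^(1/d) and e / K ≥ (1 + d)^(1 + 1/d). Their product
-- is the condition 2 (1 + d) q^d ≤ 1 for q = (1 + d) K² / (c e).
roots-bound : ∀ d K c e →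
  2 ℕ.^ 1 ℕ.* K ℕ.^ d ℕ.≤ c ℕ.^ d →
  suc d ℕ.^ suc d ℕ.* K ℕ.^ d ℕ.≤ e ℕ.^ d →
  2 ℕ.* (suc d ℕ.* (suc d ℕ.* (K ℕ.* K)) ℕ.^ d) ℕ.≤ (c ℕ.* e) ℕ.^ d
roots-bound d K c e hc he = begin
  2 ℕ.* (suc d ℕ.* (suc d ℕ.* (K ℕ.* K)) ℕ.^ d)
    ≡⟨ cong (λ x → 2 ℕ.* (suc d ℕ.* x)) (trans (^-distribʳ-* d (suc d) (K ℕ.* K))
         (cong (suc d ℕ.^ d ℕ.*_) (^-distribʳ-* d K K))) ⟩
  2 ℕ.* (suc d ℕ.* (suc d ℕ.^ d ℕ.* (K ℕ.^ d ℕ.* K ℕ.^ d)))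
    ≡⟨ solve 3 (λ a b x → con 2 :* (a :* (b :* (x :* x))) := con 2 :* x :* (a :* b :* x)) refl
         (suc d) (suc d ℕ.^ d) (K ℕ.^ d) ⟩
  2 ℕ.* K ℕ.^ d ℕ.* (suc d ℕ.^ suc d ℕ.* K ℕ.^ d)
    ≤⟨ ℕ.*-mono-≤ hc he ⟩
  c ℕ.^ d ℕ.* e ℕ.^ d
    ≡⟨ ^-distribʳ-* d c e ⟨
  (c ℕ.* e) ℕ.^ d ∎
  where
  open ℕ.≤-Reasoning
  open +-*-Solver using (solve; _:+_; _:*_; _:=_; con)

discrete-bound : ∀ {n} (G : Graph n) d .{{_ : NonZero d}} →
  (∀ v → d ℕ.≤ degree G v) → (∀ v → d ℕ.≤ degree (complement G) v) →
  ∀ s t .{{_ : NonZero t}} → 2 ℕ.* (suc d ℕ.* s ℕ.^ d) ℕ.≤ t ℕ.^ d →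
  suc d ℕ.* (globalDominationNumber G ℕ.* t) ℕ.+ n ℕ.* (d ℕ.* s) ℕ.≤ suc d ℕ.* (n ℕ.* t)
discrete-bound {n} G d d≤ d≤̄ s t {{t≢0}} h = go (t ℕ.∸ s) (ℕ.m∸n+n≡m s≤t) h
  where
  -- The condition on q forces q ≤ 1, so t - s is a legitimate weight `r`.
  s≤t : s ℕ.≤ t
  s≤t = ^-cancel-≤ d (ℕ.≤-trans (ℕ.m≤n*m (s ℕ.^ d) (suc d))
    (ℕ.≤-trans (ℕ.m≤n*m (suc d ℕ.* s ℕ.^ d) 2) h))
  -- Matching on the equation turns `t` into the sum r + s that `WeightedSum` works with.
  go : ∀ r → r ℕ.+ s ≡ t → 2 ℕ.* (suc d ℕ.* s ℕ.^ d) ℕ.≤ t ℕ.^ d →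
       suc d ℕ.* (globalDominationNumber G ℕ.* t) ℕ.+ n ℕ.* (d ℕ.* s) ℕ.≤ suc d ℕ.* (n ℕ.* t)
  go r refl = expectation-at-optimum d (globalDominationNumber G) n r s {{t≢0}}
    (WeightedSum.expectation-bound r s {{t≢0}} G d≤ d≤̄)

approx-nonZero : ∀ q .{{_ : NonZero q}} a .{{_ : NonZero a}} k → NonZero (approx q a k)
approx-nonZero q a k = ℕ.>-nonZero (ℕ.<-≤-trans (s≤s z≤n) (approx-≥ q a k))

-- Stated for any positive `d` below all degrees of both graphs, so that `d` can be matched as a
-- successor, which exposes the denominators of the exponents.
globalDominationNumber-bound : ∀ {n} (G : Graph n) d .{{_ : NonZero d}} →
  (∀ v → d ℕ.≤ degree G v) → (∀ v → d ℕ.≤ degree (complement G) v) →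
  fromℕ (globalDominationNumber G) ≤
    (fromℕ 1 - fromℕ d / (2 ^ ((+ 1) ℚ./ d) * (1 ℕ.+ d) ^ (1ℚ ℚ.+ (+ 1) ℚ./ d))) * fromℕ n
globalDominationNumber-bound {n} G d@(suc d₀) d≤ d≤̄ ε 0<ε =
  0 , λ k _ → ℚ.≤-trans (termwise k) (p≤p+ε _)
  where
  γ = globalDominationNumber G
  p≤p+ε : ∀ p → p ℚ.≤ p ℚ.+ ε
  p≤p+ε p = subst (ℚ._≤ p ℚ.+ ε) (ℚ.+-identityʳ p) (ℚ.+-monoʳ-≤ p (ℚ.<⇒≤ 0<ε))
  termwise : ∀ k → ι γ ℚ.≤
    (1ℚ ℚ.- ι d ℚ.* recip (seq (2 ^ ((+ 1) ℚ./ d)) k ℚ.*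
                           seq ((1 ℕ.+ d) ^ (1ℚ ℚ.+ (+ 1) ℚ./ d)) k)) ℚ.* ι n
  termwise k = subst (λ p → ι γ ℚ.≤ (1ℚ ℚ.- ι d ℚ.* recip p) ℚ.* ι n)
    (sym (cong₂ ℚ._*_ (^-seq 2 (1/d≡ d₀) k) (^-seq (suc d) (1+1/d≡ d₀) k)))
    -- Multiplying by 1 + d turns n d K² into n d s with s = (1 + d) K², the form in which the
    -- discrete bound applies.
    (ratio-bound γ n d c e k (ℕ.*-cancelˡ-≤ (suc d) (begin
      suc d ℕ.* (γ ℕ.* (c ℕ.* e) ℕ.+ n ℕ.* (d ℕ.* (K ℕ.* K)))
        ≡⟨ solve 5 (λ D x n d K → D :* (x :+ n :* (d :* K)) := D :* x :+ n :* (d :* (D :* K)))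
             refl (suc d) (γ ℕ.* (c ℕ.* e)) n d (K ℕ.* K) ⟩
      suc d ℕ.* (γ ℕ.* (c ℕ.* e)) ℕ.+ n ℕ.* (d ℕ.* (suc d ℕ.* (K ℕ.* K)))
        ≤⟨ discrete-bound G d d≤ d≤̄ (suc d ℕ.* (K ℕ.* K)) (c ℕ.* e) {{ℕ.m*n≢0 c e}}
             (roots-bound d K c e (⌈root⌉-upper d _) (⌈root⌉-upper d _)) ⟩
      suc d ℕ.* (n ℕ.* (c ℕ.* e)) ∎)))
    where
    open ℕ.≤-Reasoning
    open +-*-Solver using (solve; _:+_; _:*_; _:=_)
    -- q = s / t for s = (1 + d) K² and t = c e, that is, q = (1 + d) / (x y)
    -- where x = c / K ≥ 2^(1/d) and y = e / K ≥ (1 + d)^(1 + 1/d).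
    K = suc k
    c = approx d (2 ℕ.^ 1) k
    e = approx d (suc d ℕ.^ suc d) k
    instance
      c≢0 : NonZero c
      c≢0 = approx-nonZero d (2 ℕ.^ 1) k
      e≢0 : NonZero e
      e≢0 = approx-nonZero d (suc d ℕ.^ suc d) {{ℕ.m^n≢0 (suc d) (suc d)}} k

theorem10 : ∀ {n : ℕ} (G : Graph n) →
  let δ  = minDegree G
      δ̄  = minDegree (complement G)
      δ′ = δ ℕ.⊓ δ̄
  in (δ′>0 : 0 ℕ.< δ′) →
  let instance _ = ℕ.>-nonZero δ′>0
  in fromℕ (globalDominationNumber G) ≤
       (fromℕ 1 - fromℕ δ′ / (2 ^ ((+ 1) ℚ./ δ′) * (1 ℕ.+ δ′) ^ (1ℚ ℚ.+ (+ 1) ℚ./ δ′))) * fromℕ n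
theorem10 G δ′>0 = globalDominationNumber-bound G _ {{ℕ.>-nonZero δ′>0}}
  (λ v → ℕ.≤-trans (ℕ.m⊓n≤m δ δ̄) (minDegree≤degree G v))
  (λ v → ℕ.≤-trans (ℕ.m⊓n≤n δ δ̄) (minDegree≤degree (complement G) v))
  where
  δ = minDegree G
  δ̄ = minDegree (complement G)
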